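{- Let $t>s\ge 0$ be fixed integers. Then there is a function $\varepsilon(n)\to 0$ as $n\to\infty$ such that for all sufficiently large $n$ there exists a family $\mathcal{F}\subset\{0,1\}^n$ with $|\mathcal{F}|\ge\left(1/\binom{t}{s}-\varepsilon(n)\right)\binom{n}{t-s}$ such that for every two distinct $\vec{x},\vec{y}\in\mathcal{F}$, the Hamming distance $d(\vec{x},\vec{y})$ lies in $\{2s+1,2s+2,\dots,2t\}$.
   Context: The Hamming distance $d(\vec{x},\vec{y})$ between two vectors is the number of coordinates in which they differ. -}

module Defs where

open import Data.Nat using (ℕ; zero; suc; _+_)
open import Data.Bool using (Bool; true; false; if_then_else_)
open import Data.Bool.Properties using () renaming (_≟_ to _≟ᵇ_)
open import Data.Vec using (Vec; []; _∷_)
open import Data.Rational using (ℚ; 0ℚ; _/_; _<_; ∣_∣)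
open import Data.Integer using (+_)
open import Data.Product using (∃-syntax)
open import Relation.Nullary using (does)
open import Data.Nat using (_≤_)

hamming : ∀ {n} → Vec Bool n → Vec Bool n → ℕ
hamming [] [] = 0
hamming (a ∷ xs) (b ∷ ys) =
  (if does (a ≟ᵇ b) then 0 else 1) + hamming xs ys

-- 1/k as a rational number (k ≥ 1); the value at k = 0 is an
-- irrelevant convention (set to 0), never used since C(t,s) ≥ 1 for s < t.
recipℕ : ℕ → ℚ
recipℕ zero = 0ℚ
recipℕ (suc k) = (+ 1) / suc k

TendsToZero : (ℕ → ℚ) → Set
TendsToZero ε = ∀ (δ : ℚ) → 0ℚ < δ → ∃[ N ] (∀ n → N ≤ n → ∣ ε n ∣ < δ)

{-# OPTIONS --safe #-}
-- Put r = t - s. Two t-sets sharing fewer than r points are at distance between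
-- 2 s + 2 and 2 t, so it suffices to pack almost all r-sets of points into t-sets
-- no two of which share r points. We do this algebraically.
--
-- The points are pairs of one of M nodes 2 ^ i and a vector (z_v), v ≤ 2 ^ M,
-- over Z/q, where q ≡ 1 modulo a factorial makes all relevant differences units.
-- A codeword lies over a t-set T of nodes and is a family of polynomials p_v of
-- degree at most r, evaluated at the nodes of T. Their coefficients c_v of X^r are
-- subject to Σ c_v = 0, and their coefficients b_v of X^(r-1) are given by
-- b_v + v c_v = target v; all others are free.
--
-- Suppose two codewords, over T and T′, agree over a set R of r nodes with sum e.
-- By Vieta the differences satisfy δb_v + e δc_v = 0. For v = e this says that the
-- two targets at e agree. Since e determines R, the target at e can encode a number
-- j together with the position of T among the D supersets of R, so T = T′ and
-- j = j′. Then (e - v) δc_v = 0, hence δc_v = 0 for v ≠ e, and for v = e by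
-- Σ δc_v = 0. The remaining difference has degree below r - 1 and r roots, so the
-- codewords coincide. As j takes (q - 1) / D values, the codewords cover almost all
-- r-sets of points over r different nodes.
module Submission where

open import Defs
open import Data.Bool using (Bool; true; false)
open import Data.Empty using (⊥-elim)
open import Data.Fin using (Fin; zero; suc; toℕ; fromℕ<; combine; funToFin; finToFun)
import Data.Fin.Properties as Fin
open import Data.Fin.Subset using (⊥; ⁅_⁆) renaming (∣_∣ to size)
open import Data.List using (List; []; _∷_; length; allFin; cartesianProduct; cartesianProductWith)
import Data.List as List
open import Data.List.Membership.Propositional using (_∈_)
open import Data.List.Membership.Propositional.Properties using (∈-map⁻)
open import Data.List.Properties using (length-map; length-++; length-tabulate)
open import Data.List.Relation.Unary.All using ([])
open import Data.List.Relation.Unary.Unique.Propositional using (Unique; []; _∷_)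
import Data.List.Relation.Unary.Unique.Propositional.Properties as Unique
open import Data.Nat.Combinatorics using (_C_; nCk≡nC[n∸k]; nCk+nC[k+1]≡[n+1]C[k+1]; k>n⇒nCk≡0)
import Data.Nat.Divisibility as ℕ
open import Data.Product using (Σ; Σ-syntax; ∃-syntax; _×_; _,_; proj₁; proj₂)
open import Data.Sum using (inj₁; inj₂)
open import Data.Vec using (Vec; []; _∷_; _++_; lookup; map; sum; zipWith)
open import Data.Vec.Relation.Unary.All as All using (All; []; _∷_)
open import Data.Vec.Relation.Unary.AllPairs as AllPairs using (AllPairs; []; _∷_)
open import Relation.Binary.PropositionalEquality
open import Relation.Nullary using (yes; no; contradiction)

-- Polynomials over the integers and their roots modulo `q`.

module Polynomials where

  open import Data.Nat as ℕ using (ℕ; zero; suc; NonZero)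
  import Data.Nat.Properties as ℕ
  open import Data.Integer using (ℤ; +_; _+_; _-_; _*_; -_; 0ℤ; ∣_∣; _%ℕ_; _/ℕ_)
  import Data.Integer.Properties as ℤ
  open import Data.Integer.DivMod using (a≡a%ℕn+[a/ℕn]*n)
  open import Data.Integer.Divisibility.Signed
  open import Data.Integer.Tactic.RingSolver using (solve-∀)

  private variable n : ℕ

  -- eval g f x = g₀ + g₁ x + … + gₙ₋₁ xⁿ⁻¹ + f(x) xⁿ.
  eval : Vec ℤ n → (ℤ → ℤ) → ℤ → ℤ
  eval []      f x = f x
  eval (a ∷ g) f x = a + x * eval g f x

  -- As the tail of `eval` it supplies the top two coefficients, kept apart from `g` because they
  -- are constrained rather than free.
  lin : ℤ → ℤ → ℤ → ℤ
  lin b c x = b + x * c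

  -- Synthetic division: the Horner values at `y` are the low coefficients of the quotient of
  -- `x * eval g f x - y * eval g f y` by `x - y`.
  quot : Vec ℤ n → (ℤ → ℤ) → ℤ → Vec ℤ n
  quot []      f y = []
  quot (a ∷ g) f y = eval (a ∷ g) f y ∷ quot g f y

  -- The quotient `f′` of the tail is left abstract, so that one induction serves both the zero tail
  -- and the linear tail.
  eval-quot : ∀ f f′ y → (∀ x → x * f x - y * f y ≡ (x - y) * f′ x) →
    ∀ (g : Vec ℤ n) x →
    x * eval g f x - y * eval g f y ≡ (x - y) * eval (quot g f y) f′ x
  eval-quot f f′ y h []      x = h x
  eval-quot f f′ y h (a ∷ g) x = begin
    x * (a + x * X) - y * (a + y * Y)         ≡⟨ step₁ a x y X Y ⟩
    (x - y) * (a + y * Y) + x * (x * X - y * Y)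
      ≡⟨ cong (λ z → (x - y) * (a + y * Y) + x * z) (eval-quot f f′ y h g x) ⟩
    (x - y) * (a + y * Y) + x * ((x - y) * Z) ≡⟨ step₂ (a + y * Y) x y Z ⟩
    (x - y) * (a + y * Y + x * Z)             ∎
    where
    open ≡-Reasoning
    X = eval g f x
    Y = eval g f y
    Z = eval (quot g f y) f′ x
    step₁ : ∀ a x y X Y → x * (a + x * X) - y * (a + y * Y)
          ≡ (x - y) * (a + y * Y) + x * (x * X - y * Y)
    step₁ = solve-∀
    step₂ : ∀ A x y Z → (x - y) * A + x * ((x - y) * Z) ≡ (x - y) * (A + x * Z)
    step₂ = solve-∀

  eval-quot-root : ∀ f f′ y → (∀ x → x * f x - y * f y ≡ (x - y) * f′ x) →
    ∀ a (g : Vec ℤ n) x →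
    eval (a ∷ g) f x - eval (a ∷ g) f y ≡ (x - y) * eval (quot g f y) f′ x
  eval-quot-root f f′ y h a g x =
    trans (cancel a (x * eval g f x) (y * eval g f y)) (eval-quot f f′ y h g x)
    where
    cancel : ∀ a u v → (a + u) - (a + v) ≡ u - v
    cancel = solve-∀

  eval-difference : ∀ b b′ c c′ (g g′ : Vec ℤ n) x →
    eval (zipWith _-_ g g′) (lin (b - b′) (c - c′)) x
    ≡ eval g (lin b c) x - eval g′ (lin b′ c′) x
  eval-difference b b′ c c′ [] [] x = identity b b′ c c′ x
    where
    identity : ∀ b b′ c c′ x → (b - b′) + x * (c - c′) ≡ (b + x * c) - (b′ + x * c′)
    identity = solve-∀
  eval-difference b b′ c c′ (a ∷ g) (a′ ∷ g′) x =
    trans (cong (λ z → (a - a′) + x * z) (eval-difference b b′ c c′ g g′ x))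
          (identity a a′ x (eval g (lin b c) x) (eval g′ (lin b′ c′) x))
    where
    identity : ∀ a a′ x u v → (a - a′) + x * (u - v) ≡ (a + x * u) - (a′ + x * v)
    identity = solve-∀

  ∑ : ∀ {m} → (Fin m → ℤ) → ℤ
  ∑ {zero}  c = 0ℤ
  ∑ {suc m} c = c zero + ∑ (λ i → c (suc i))

  ∑-difference : ∀ a a′ u u′ → (a + u) - (a′ + u′) ≡ (a - a′) + (u - u′)
  ∑-difference = solve-∀

  -- Parametrises the families of `suc m` integers with sum zero by their last `m` entries.
  balanced : ∀ {m} → (Fin m → ℤ) → Fin (suc m) → ℤ
  balanced c zero    = - ∑ c
  balanced c (suc i) = c i

  module Congruence (q : ℕ) where

    Zero : ℤ → Set
    Zero x = + q ∣ x

    Zero-0 : Zero 0ℤ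
    Zero-0 = divides 0ℤ refl

    -- The modulus may be composite, so division in a field is replaced by cancellation of suitable
    -- differences.
    Regular : ℤ → Set
    Regular d = ∀ x → Zero (d * x) → Zero x

    Separated : ℕ → ℕ → Set
    Separated x y = Regular (+ y - + x)

    private
      -- Each coefficient is a Horner value minus `y` times the next Horner value.
      quot-zero : ∀ y (g : Vec ℤ n) → All Zero (quot g (λ _ → 0ℤ) y) →
        All Zero g × Zero (eval g (λ _ → 0ℤ) y)
      quot-zero y []      []       = [] , Zero-0
      quot-zero y (a ∷ g) (z ∷ zs) with quot-zero y g zs
      ... | zg , ze = ∣m+n∣n⇒∣m {m = a} z (∣n⇒∣m*n y ze) ∷ zg , z

    -- Dividing out the first root leaves one coefficient fewer; the other nodes remain roots
    -- because their differences from `x` can be cancelled.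
    enough-roots⇒zero : ∀ (g : Vec ℤ n) (xs : Vec ℕ n) → AllPairs Separated xs →
      All (λ x → Zero (eval g (λ _ → 0ℤ) (+ x))) xs → All Zero g
    enough-roots⇒zero []      []       _        _        = []
    enough-roots⇒zero (a ∷ g) (x ∷ xs) (s ∷ ss) (z ∷ zs) =
      let zg , ze = quot-zero (+ x) g
            (enough-roots⇒zero (quot g _ (+ x)) xs ss
              (All.map (λ {y} (s , z′) → s _ (subst Zero
                  (eval-quot-root _ _ (+ x) (λ y → zero-tail y (+ x)) a g (+ y))
                  (∣m∣n⇒∣m-n z′ z)))
                (All.zip (s , zs))))
      in ∣m+n∣n⇒∣m {m = a} z (∣n⇒∣m*n (+ x) ze) ∷ zg
      where
      zero-tail : ∀ x y → x * 0ℤ - y * 0ℤ ≡ (x - y) * 0ℤ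
      zero-tail = solve-∀

    -- Vieta's formula, by dividing out the roots one at a time since c need not be a unit.
    top-coefficients : ∀ (g : Vec ℤ n) b c (xs : Vec ℕ (suc n)) → AllPairs Separated xs →
      All (λ x → Zero (eval g (lin b c) (+ x))) xs → Zero (b + + (sum xs) * c)
    top-coefficients [] b c (x ∷ []) _ (z ∷ []) rewrite ℕ.+-identityʳ x = z
    top-coefficients (a ∷ g) b c (x ∷ xs) (s ∷ ss) (z ∷ zs) =
      subst Zero (trans (regroup b c (+ x) (+ sum xs))
                        (cong (λ z → b + z * c) (sym (ℤ.pos-+ x (sum xs)))))
        (top-coefficients (quot g _ (+ x)) (b + + x * c) c xs ss
          (All.map (λ {y} (s , z′) → s _ (subst Zero
              (eval-quot-root _ _ (+ x) (λ y → lin-tail b c y (+ x)) a g (+ y))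
              (∣m∣n⇒∣m-n z′ z)))
            (All.zip (s , zs))))
      where
      lin-tail : ∀ b c x y → x * (b + x * c) - y * (b + y * c) ≡ (x - y) * ((b + y * c) + x * c)
      lin-tail = solve-∀
      regroup : ∀ b c x s → (b + x * c) + s * c ≡ b + (x + s) * c
      regroup = solve-∀

    eval-zero-tail : ∀ (g : Vec ℤ n) {b c} → b ≡ 0ℤ → c ≡ 0ℤ → ∀ x →
      eval g (lin b c) x ≡ eval g (λ _ → 0ℤ) x
    eval-zero-tail [] refl refl x = trans (ℤ.+-identityˡ (x * 0ℤ)) (ℤ.*-zeroʳ x)
    eval-zero-tail (a ∷ g) b≡0 c≡0 x = cong (λ z → a + x * z) (eval-zero-tail g b≡0 c≡0 x)

    same-residue⇒Zero : ∀ .{{_ : NonZero q}} x y → x %ℕ q ≡ y %ℕ q → Zero (x - y)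
    same-residue⇒Zero x y eq = divides (x /ℕ q - y /ℕ q) (begin
      x - y
        ≡⟨ cong₂ _-_ (a≡a%ℕn+[a/ℕn]*n x q) (a≡a%ℕn+[a/ℕn]*n y q) ⟩
      (+ (x %ℕ q) + (x /ℕ q) * + q) - (+ (y %ℕ q) + (y /ℕ q) * + q)
        ≡⟨ cong (λ z → (+ z + (x /ℕ q) * + q) - (+ (y %ℕ q) + (y /ℕ q) * + q)) eq ⟩
      (+ (y %ℕ q) + (x /ℕ q) * + q) - (+ (y %ℕ q) + (y /ℕ q) * + q)
        ≡⟨ identity (+ (y %ℕ q)) (x /ℕ q) (y /ℕ q) (+ q) ⟩
      (x /ℕ q - y /ℕ q) * + q ∎)
      where
      open ≡-Reasoning
      identity : ∀ r u v q → (r + u * q) - (r + v * q) ≡ (u - v) * q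
      identity = solve-∀

    Zero⇒≡ : ∀ {x y} → x ℕ.< q → y ℕ.< q → Zero (+ x - + y) → x ≡ y
    Zero⇒≡ {x} {y} x<q y<q z with ∣ + x - + y ∣ in eq
    ... | zero  = ℤ.+-injective (ℤ.i-j≡0⇒i≡j (+ x) (+ y) (ℤ.∣i∣≡0⇒i≡0 eq))
    ... | suc d = ⊥-elim (ℕ.<⇒≱ (ℕ.≤-<-trans bound (ℕ.⊔-lub x<q y<q))
                    (ℕ.∣⇒≤ (subst (q ℕ.∣_) eq (∣⇒∣ᵤ z))))
      where
      bound : suc d ℕ.≤ x ℕ.⊔ y
      bound = subst (ℕ._≤ x ℕ.⊔ y)
        (trans (cong ∣_∣ (sym (ℤ.m-n≡m⊖n x y))) eq) (ℤ.∣m⊝n∣≤m⊔n x y)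

    ∑-zero : ∀ {m} {c c′ : Fin m → ℤ} → (∀ i → Zero (c i - c′ i)) → Zero (∑ c - ∑ c′)
    ∑-zero {zero}  zs = Zero-0
    ∑-zero {suc m} {c} {c′} zs =
      subst Zero (sym (∑-difference (c zero) (c′ zero) (∑ (λ i → c (suc i))) (∑ (λ i → c′ (suc i)))))
        (∣m∣n⇒∣m+n (zs zero) (∑-zero (λ i → zs (suc i))))

    all-but-one : ∀ {m} (c c′ : Fin m → ℤ) i₀ → Zero (∑ c - ∑ c′) →
      (∀ i → i ≢ i₀ → Zero (c i - c′ i)) → Zero (c i₀ - c′ i₀)
    all-but-one c c′ zero z zs =
      ∣m+n∣n⇒∣m {m = c zero - c′ zero}
        (subst Zero (∑-difference (c zero) (c′ zero) (∑ (λ i → c (suc i))) (∑ (λ i → c′ (suc i)))) z)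
        (∑-zero (λ i → zs (suc i) λ ()))
    all-but-one c c′ (suc i₀) z zs =
      all-but-one (λ i → c (suc i)) (λ i → c′ (suc i)) i₀
        (∣m+n∣m⇒∣n {m = c zero - c′ zero}
          (subst Zero (∑-difference (c zero) (c′ zero) (∑ (λ i → c (suc i))) (∑ (λ i → c′ (suc i)))) z)
          (zs zero λ ()))
        (λ i i≢ → zs (suc i) (λ eq → i≢ (Fin.suc-injective eq)))

    -- If the exceptional index is not `zero`, the congruence at `zero` says that the sums of the
    -- free entries agree, which forces the one missing entry.
    balanced-all-but-one : ∀ {m} (c c′ : Fin m → ℤ) s₀ →
      (∀ s → s ≢ s₀ → Zero (balanced c s - balanced c′ s)) → ∀ i → Zero (c i - c′ i)
    balanced-all-but-one c c′ zero     zs i = zs (suc i) λ ()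
    balanced-all-but-one c c′ (suc i₀) zs i with i Fin.≟ i₀
    ... | no i≢    = zs (suc i) (λ eq → i≢ (Fin.suc-injective eq))
    ... | yes refl = all-but-one c c′ i₀
      (subst Zero (identity (∑ c) (∑ c′)) (∣m⇒∣-m (zs zero λ ())))
      (λ j j≢ → zs (suc j) (λ eq → j≢ (Fin.suc-injective eq)))
      where
      identity : ∀ u v → - (- u - - v) ≡ u - v
      identity = solve-∀

-- Subsets of fixed size, their binary codes and their ranks.

module Subsets where

  open import Data.Nat
  open import Data.Nat.Properties
  open import Data.Nat.Tactic.RingSolver using (solve-∀)

  private variable n k l a Q : ℕ

  -- The head of a subset of an (n + 1)-element set decides about the point n,
  -- which is represented by the node 2 ^ n.
  data Choose : ℕ → ℕ → Set where
    []   : Choose 0 0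
    in∷  : Choose n k → Choose (suc n) (suc k)
    out∷ : Choose n k → Choose (suc n) k

  infix 4 _⊆_
  data _⊆_ : Choose n k → Choose n l → Set where
    []   : [] ⊆ []
    both : {R : Choose n k} {T : Choose n l} → R ⊆ T → in∷ R ⊆ in∷ T
    skip : {R : Choose n k} {T : Choose n l} → R ⊆ T → out∷ R ⊆ in∷ T
    drop : {R : Choose n k} {T : Choose n l} → R ⊆ T → out∷ R ⊆ out∷ T

  ⊆-trans : {A : Choose n a} {R : Choose n k} {T : Choose n l} → A ⊆ R → R ⊆ T → A ⊆ T
  ⊆-trans []       []       = []
  ⊆-trans (both p) (both q) = both (⊆-trans p q)
  ⊆-trans (skip p) (both q) = skip (⊆-trans p q)
  ⊆-trans (drop p) (skip q) = skip (⊆-trans p q)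
  ⊆-trans (drop p) (drop q) = drop (⊆-trans p q)

  ⊆⇒≤ : {R : Choose n k} {T : Choose n l} → R ⊆ T → k ≤ l
  ⊆⇒≤ []       = z≤n
  ⊆⇒≤ (both p) = s≤s (⊆⇒≤ p)
  ⊆⇒≤ (skip p) = m≤n⇒m≤1+n (⊆⇒≤ p)
  ⊆⇒≤ (drop p) = ⊆⇒≤ p

  Choose⇒≤ : Choose n k → k ≤ n
  Choose⇒≤ []       = z≤n
  Choose⇒≤ (in∷ T)  = s≤s (Choose⇒≤ T)
  Choose⇒≤ (out∷ T) = m≤n⇒m≤1+n (Choose⇒≤ T)

  shrink : k ≤ a → (A : Choose n a) → Σ[ R ∈ Choose n k ] R ⊆ A
  shrink z≤n     []       = [] , []
  shrink z≤n     (in∷ A)  = let R , p = shrink z≤n A in out∷ R , skip p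
  shrink (s≤s h) (in∷ A)  = let R , p = shrink h A in in∷ R , both p
  shrink h       (out∷ A) = let R , p = shrink h A in out∷ R , drop p

  nodes : Choose n k → Vec ℕ k
  nodes []              = []
  nodes (in∷ {n = n} T) = 2 ^ n ∷ nodes T
  nodes (out∷ T)        = nodes T

  nodes-⊆ : {P : ℕ → Set} {R : Choose n k} {T : Choose n l} → R ⊆ T → All P (nodes T) → All P (nodes R)
  nodes-⊆ []       []       = []
  nodes-⊆ (both p) (h ∷ hs) = h ∷ nodes-⊆ p hs
  nodes-⊆ (skip p) (h ∷ hs) = nodes-⊆ p hs
  nodes-⊆ (drop p) hs       = nodes-⊆ p hs

  -- The node sum that enters Vieta's formula. Since the nodes are distinct powers of two, its
  -- binary digits spell out `T`.
  code : Choose n k → ℕ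
  code T = sum (nodes T)

  2^n+2^n : ∀ n → 2 ^ n + 2 ^ n ≡ 2 ^ suc n
  2^n+2^n n = cong (2 ^ n +_) (sym (+-identityʳ (2 ^ n)))

  2^n<2^[1+n] : ∀ n → 2 ^ n < 2 ^ suc n
  2^n<2^[1+n] n = ^-monoʳ-< 2 (s≤s (s≤s z≤n)) (n<1+n n)

  code<2^n : (T : Choose n k) → code T < 2 ^ n
  code<2^n []              = s≤s z≤n
  code<2^n (in∷ {n = n} T) =
    subst (2 ^ n + code T <_) (2^n+2^n n) (+-monoʳ-< (2 ^ n) (code<2^n T))
  code<2^n (out∷ {n = n} T) = <-trans (code<2^n T) (2^n<2^[1+n] n)

  nodes<2^n : (T : Choose n k) → All (_< 2 ^ n) (nodes T)
  nodes<2^n []               = []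
  nodes<2^n (in∷ {n = n} T)  = 2^n<2^[1+n] n ∷ All.map (λ h → <-trans h (2^n<2^[1+n] n)) (nodes<2^n T)
  nodes<2^n (out∷ {n = n} T) = All.map (λ h → <-trans h (2^n<2^[1+n] n)) (nodes<2^n T)

  nodes-distinct : (T : Choose n k) → AllPairs (λ x y → y < x × x < 2 ^ n) (nodes T)
  nodes-distinct T = go T (λ h → h)
    where
    -- The bound `b` stays fixed while `n` decreases along the recursion.
    go : ∀ {b} (T : Choose n k) → (∀ {x} → x < 2 ^ n → x < b) → AllPairs (λ x y → y < x × x < b) (nodes T)
    go []               h = []
    go (in∷ {n = n} T)  h = All.map (_, h (2^n<2^[1+n] n)) (nodes<2^n T)
                          ∷ go T (λ x< → h (<-trans x< (2^n<2^[1+n] n)))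
    go (out∷ {n = n} T) h = go T (λ x< → h (<-trans x< (2^n<2^[1+n] n)))

  ⌊_⌋ : Choose n k → Vec Bool n
  ⌊ [] ⌋     = []
  ⌊ in∷ T ⌋  = true ∷ ⌊ T ⌋
  ⌊ out∷ T ⌋ = false ∷ ⌊ T ⌋

  size-⌊⌋ : (T : Choose n k) → size ⌊ T ⌋ ≡ k
  size-⌊⌋ []       = refl
  size-⌊⌋ (in∷ T)  = cong suc (size-⌊⌋ T)
  size-⌊⌋ (out∷ T) = size-⌊⌋ T

  -- Greedy binary expansion, defined for every number because `target` is evaluated at indices that
  -- are not codes of `r`-sets too.
  decode : ∀ n → ℕ → Vec Bool n
  decode zero    x = []
  decode (suc n) x with 2 ^ n ≤? x
  ... | yes _ = true ∷ decode n (x ∸ 2 ^ n)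
  ... | no  _ = false ∷ decode n x

  decode-code : (T : Choose n k) → decode n (code T) ≡ ⌊ T ⌋
  decode-code [] = refl
  decode-code (in∷ {n = n} T) with 2 ^ n ≤? 2 ^ n + code T
  ... | yes _ = cong (true ∷_) (trans (cong (decode n) (m+n∸m≡n (2 ^ n) (code T))) (decode-code T))
  ... | no h  = contradiction (m≤m+n (2 ^ n) (code T)) h
  decode-code (out∷ {n = n} T) with 2 ^ n ≤? code T
  ... | yes h = contradiction h (<⇒≱ (code<2^n T))
  ... | no _  = cong (false ∷_) (decode-code T)

  -- The position of T among the k-element supersets of R; junk unless R ⊆ T.
  rank : Vec Bool n → Choose n k → ℕ
  rank []          []       = 0
  rank (true  ∷ R) (in∷ T)  = rank R T
  rank (true  ∷ R) (out∷ T) = rank R T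
  rank (false ∷ R) (out∷ T) = rank R T
  rank (false ∷ R) (in∷ {n = n} {k = k} T) = (n ∸ size R) C (suc k ∸ size R) + rank R T

  C-monoˡ-suc : ∀ n k → n C k ≤ suc n C k
  C-monoˡ-suc n zero    = ≤-refl
  C-monoˡ-suc n (suc k) =
    ≤-trans (m≤n+m (n C suc k) (n C k)) (≤-reflexive (nCk+nC[k+1]≡[n+1]C[k+1] n k))

  -- Supersets that omit the top point are numbered first and those that contain it follow, so the
  -- two counts add up by Pascal's rule.
  rank-< : {R : Choose n k} {T : Choose n l} → R ⊆ T → rank ⌊ R ⌋ T < (n ∸ k) C (l ∸ k)
  rank-< []       = s≤s z≤n
  rank-< (both p) = rank-< p
  rank-< {suc n} {k} {suc l} {out∷ R} {in∷ T} (skip p) = begin-strict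
    (n ∸ size ⌊ R ⌋) C (suc l ∸ size ⌊ R ⌋) + rank ⌊ R ⌋ T
      ≡⟨ cong (λ z → (n ∸ z) C (suc l ∸ z) + rank ⌊ R ⌋ T) (size-⌊⌋ R) ⟩
    (n ∸ k) C (suc l ∸ k) + rank ⌊ R ⌋ T       <⟨ +-monoʳ-< ((n ∸ k) C (suc l ∸ k)) (rank-< p) ⟩
    (n ∸ k) C (suc l ∸ k) + (n ∸ k) C (l ∸ k)
      ≡⟨ cong (λ z → (n ∸ k) C z + (n ∸ k) C (l ∸ k)) (+-∸-assoc 1 (⊆⇒≤ p)) ⟩
    (n ∸ k) C suc (l ∸ k) + (n ∸ k) C (l ∸ k)  ≡⟨ +-comm ((n ∸ k) C suc (l ∸ k)) _ ⟩
    (n ∸ k) C (l ∸ k) + (n ∸ k) C suc (l ∸ k)  ≡⟨ nCk+nC[k+1]≡[n+1]C[k+1] (n ∸ k) (l ∸ k) ⟩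
    suc (n ∸ k) C suc (l ∸ k)
      ≡⟨ cong₂ _C_ (+-∸-assoc 1 (Choose⇒≤ R)) (+-∸-assoc 1 (⊆⇒≤ p)) ⟨
    (suc n ∸ k) C (suc l ∸ k)                  ∎
    where open ≤-Reasoning
  rank-< {suc n} {k} {l} {out∷ R} {out∷ T} (drop p) = begin-strict
    rank ⌊ R ⌋ T            <⟨ rank-< p ⟩
    (n ∸ k) C (l ∸ k)       ≤⟨ C-monoˡ-suc (n ∸ k) (l ∸ k) ⟩
    suc (n ∸ k) C (l ∸ k)   ≡⟨ cong (_C (l ∸ k)) (+-∸-assoc 1 (Choose⇒≤ R)) ⟨
    (suc n ∸ k) C (l ∸ k)   ∎
    where open ≤-Reasoning

  -- The offset added for a set containing the top point already exceeds every rank of a set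
  -- omitting it.
  rank-skip≢drop : {R : Choose n k} {T : Choose n l} {T′ : Choose n (suc l)} → R ⊆ T′ →
    rank ⌊ out∷ R ⌋ (in∷ T) ≢ rank ⌊ out∷ R ⌋ (out∷ T′)
  rank-skip≢drop {n} {k} {l} {R} {T} p eq = <⇒≢ (begin-strict
    rank ⌊ R ⌋ _                                  <⟨ rank-< p ⟩
    (n ∸ k) C (suc l ∸ k)                         ≡⟨ cong (λ z → (n ∸ z) C (suc l ∸ z)) (size-⌊⌋ R) ⟨
    (n ∸ size ⌊ R ⌋) C (suc l ∸ size ⌊ R ⌋)       ≤⟨ m≤m+n _ _ ⟩
    (n ∸ size ⌊ R ⌋) C (suc l ∸ size ⌊ R ⌋) + rank ⌊ R ⌋ T ∎) (sym eq)
    where open ≤-Reasoning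

  rank-injective : {R : Choose n k} {T T′ : Choose n l} → R ⊆ T → R ⊆ T′ →
    rank ⌊ R ⌋ T ≡ rank ⌊ R ⌋ T′ → T ≡ T′
  rank-injective []       []        eq = refl
  rank-injective (both p) (both p′) eq = cong in∷ (rank-injective p p′ eq)
  rank-injective (skip p) (skip p′) eq = cong in∷ (rank-injective p p′ (+-cancelˡ-≡ _ _ _ eq))
  rank-injective (drop p) (drop p′) eq = cong out∷ (rank-injective p p′ eq)
  rank-injective (skip {T = T} p) (drop p′) eq = contradiction eq (rank-skip≢drop {T = T} p′)
  rank-injective (drop p) (skip {T = T} p′) eq = contradiction (sym eq) (rank-skip≢drop {T = T} p)

  allChoose : ∀ n k → List (Choose n k)
  allChoose zero    zero    = [] ∷ []
  allChoose zero    (suc k) = []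
  allChoose (suc n) zero    = List.map out∷ (allChoose n zero)
  allChoose (suc n) (suc k) = List.map in∷ (allChoose n k) List.++ List.map out∷ (allChoose n (suc k))

  length-allChoose : ∀ n k → length (allChoose n k) ≡ n C k
  length-allChoose zero    zero    = refl
  length-allChoose zero    (suc k) = sym (k>n⇒nCk≡0 {0} {suc k} (s≤s z≤n))
  length-allChoose (suc n) zero    = trans (length-map out∷ (allChoose n zero)) (length-allChoose n zero)
  length-allChoose (suc n) (suc k) = begin
    length (List.map in∷ (allChoose n k) List.++ List.map out∷ (allChoose n (suc k)))
      ≡⟨ length-++ (List.map in∷ (allChoose n k)) ⟩
    length (List.map in∷ (allChoose n k)) + length (List.map out∷ (allChoose n (suc k)))
      ≡⟨ cong₂ _+_ (length-map in∷ (allChoose n k)) (length-map out∷ (allChoose n (suc k))) ⟩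
    length (allChoose n k) + length (allChoose n (suc k))
      ≡⟨ cong₂ _+_ (length-allChoose n k) (length-allChoose n (suc k)) ⟩
    n C k + n C suc k
      ≡⟨ nCk+nC[k+1]≡[n+1]C[k+1] n k ⟩
    suc n C suc k ∎
    where open ≡-Reasoning

  in∷-injective : {T T′ : Choose n k} → in∷ T ≡ in∷ T′ → T ≡ T′
  in∷-injective refl = refl

  out∷-injective : {T T′ : Choose n k} → out∷ T ≡ out∷ T′ → T ≡ T′
  out∷-injective refl = refl

  allChoose-unique : ∀ n k → Unique (allChoose n k)
  allChoose-unique zero    zero    = [] ∷ []
  allChoose-unique zero    (suc k) = []
  allChoose-unique (suc n) zero    = Unique.map⁺ out∷-injective (allChoose-unique n zero)
  allChoose-unique (suc n) (suc k) = Unique.++⁺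
    (Unique.map⁺ in∷-injective (allChoose-unique n k))
    (Unique.map⁺ out∷-injective (allChoose-unique n (suc k)))
    λ (p , q) → case-in-out (proj₂ (proj₂ (∈-map⁻ in∷ p))) (proj₂ (proj₂ (∈-map⁻ out∷ q)))
    where
    case-in-out : ∀ {ℓ} {X : Set ℓ} {T : Choose (suc n) (suc k)} {U V} → T ≡ in∷ U → T ≡ out∷ V → X
    case-in-out refl ()

  -- Hamming distances between indicator vectors of graphs.

  hamming-refl : (x : Vec Bool n) → hamming x x ≡ 0
  hamming-refl []          = refl
  hamming-refl (true  ∷ x) = hamming-refl x
  hamming-refl (false ∷ x) = hamming-refl x

  hamming-++ : (x x′ : Vec Bool k) (y y′ : Vec Bool l) →
    hamming (x ++ y) (x′ ++ y′) ≡ hamming x x′ + hamming y y′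
  hamming-++ []      []        y y′ = refl
  hamming-++ (a ∷ x) (a′ ∷ x′) y y′ =
    trans (cong (_ +_) (hamming-++ x x′ y y′)) (sym (+-assoc _ (hamming x x′) (hamming y y′)))

  hamming-⊥-⁅⁆ : (i : Fin n) → hamming ⊥ ⁅ i ⁆ ≡ 1
  hamming-⊥-⁅⁆ {suc n} zero = cong suc (hamming-refl (⊥ {n}))
  hamming-⊥-⁅⁆ (suc i)      = hamming-⊥-⁅⁆ i

  hamming-⁅⁆-⊥ : (i : Fin n) → hamming ⁅ i ⁆ ⊥ ≡ 1
  hamming-⁅⁆-⊥ {suc n} zero = cong suc (hamming-refl (⊥ {n}))
  hamming-⁅⁆-⊥ (suc i)      = hamming-⁅⁆-⊥ i

  hamming-⁅⁆-⁅⁆ : (i j : Fin n) → i ≢ j → hamming ⁅ i ⁆ ⁅ j ⁆ ≡ 2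
  hamming-⁅⁆-⁅⁆ zero    zero    i≢j = contradiction refl i≢j
  hamming-⁅⁆-⁅⁆ zero    (suc j) i≢j = cong suc (hamming-⊥-⁅⁆ j)
  hamming-⁅⁆-⁅⁆ (suc i) zero    i≢j = cong suc (hamming-⁅⁆-⊥ i)
  hamming-⁅⁆-⁅⁆ (suc i) (suc j) i≢j = hamming-⁅⁆-⁅⁆ i j (λ eq → i≢j (cong suc eq))

  -- The indicator vector of { (x , w x) : x ∈ nodes T }.
  graph : (ℕ → Fin Q) → Choose n k → Vec Bool (n * Q)
  graph w []               = []
  graph w (in∷ {n = n} T)  = ⁅ w (2 ^ n) ⁆ ++ graph w T
  graph w (out∷ T)         = ⊥ ++ graph w T

  -- `common` collects the nodes over which the two graphs share a point, and `balance` is the size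
  -- of the symmetric difference plus twice that of the intersection.
  record Agreement {Q} (w w′ : ℕ → Fin Q) (T : Choose n k) (T′ : Choose n l) : Set where
    constructor agreement
    field
      {count} : ℕ
      common  : Choose n count
      ⊆₁      : common ⊆ T
      ⊆₂      : common ⊆ T′
      agree   : All (λ x → w x ≡ w′ x) (nodes common)
      balance : hamming (graph w T) (graph w′ T′) + 2 * count ≡ k + l

  agreement-of : (w w′ : ℕ → Fin Q) (T : Choose n k) (T′ : Choose n l) → Agreement w w′ T T′
  agreement-of w w′ [] [] = agreement [] [] [] [] refl
  agreement-of w w′ (in∷ {n = n} {k = k} T) (in∷ {k = l} T′)
    with agreement-of w w′ T T′ | w (2 ^ n) Fin.≟ w′ (2 ^ n)
  ... | agreement {count} A p p′ e b | yes eq = agreement (in∷ A) (both p) (both p′) (eq ∷ e) (begin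
    hamming (⁅ w (2 ^ n) ⁆ ++ graph w T) (⁅ w′ (2 ^ n) ⁆ ++ graph w′ T′) + 2 * suc count
      ≡⟨ cong (_+ 2 * suc count) (hamming-++ ⁅ w (2 ^ n) ⁆ ⁅ w′ (2 ^ n) ⁆ (graph w T) (graph w′ T′)) ⟩
    hamming ⁅ w (2 ^ n) ⁆ ⁅ w′ (2 ^ n) ⁆ + H + 2 * suc count
      ≡⟨ cong (λ z → z + H + 2 * suc count)
              (trans (cong (λ i → hamming ⁅ i ⁆ ⁅ w′ (2 ^ n) ⁆) eq) (hamming-refl ⁅ w′ (2 ^ n) ⁆)) ⟩
    H + 2 * suc count       ≡⟨ identity H count ⟩
    2 + (H + 2 * count)     ≡⟨ cong (2 +_) b ⟩
    2 + (k + l)             ≡⟨ cong suc (sym (+-suc k l)) ⟩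
    suc k + suc l           ∎)
    where
    open ≡-Reasoning
    H = hamming (graph w T) (graph w′ T′)
    identity : ∀ h c → h + 2 * suc c ≡ 2 + (h + 2 * c)
    identity = solve-∀
  ... | agreement {count} A p p′ e b | no w≢w′ = agreement (out∷ A) (skip p) (skip p′) e (begin
    hamming (⁅ w (2 ^ n) ⁆ ++ graph w T) (⁅ w′ (2 ^ n) ⁆ ++ graph w′ T′) + 2 * count
      ≡⟨ cong (_+ 2 * count) (hamming-++ ⁅ w (2 ^ n) ⁆ ⁅ w′ (2 ^ n) ⁆ (graph w T) (graph w′ T′)) ⟩
    hamming ⁅ w (2 ^ n) ⁆ ⁅ w′ (2 ^ n) ⁆ + hamming (graph w T) (graph w′ T′) + 2 * count
      ≡⟨ cong (λ z → z + hamming (graph w T) (graph w′ T′) + 2 * count) (hamming-⁅⁆-⁅⁆ _ _ w≢w′) ⟩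
    2 + (hamming (graph w T) (graph w′ T′) + 2 * count)     ≡⟨ cong (2 +_) b ⟩
    2 + (k + l)             ≡⟨ cong suc (sym (+-suc k l)) ⟩
    suc k + suc l           ∎)
    where open ≡-Reasoning
  agreement-of {Q = Q} w w′ (in∷ {n = n} T) (out∷ T′) with agreement-of w w′ T T′
  ... | agreement {count} A p p′ e b = agreement (out∷ A) (skip p) (drop p′) e
    (trans (cong (_+ 2 * count) (trans (hamming-++ ⁅ w (2 ^ n) ⁆ ⊥ (graph w T) (graph w′ T′))
                                       (cong (_+ hamming (graph w T) (graph w′ T′)) (hamming-⁅⁆-⊥ (w (2 ^ n))))))
           (cong suc b))
  agreement-of {Q = Q} {k = k} w w′ (out∷ {n = n} T) (in∷ {k = l} T′) with agreement-of w w′ T T′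
  ... | agreement {count} A p p′ e b = agreement (out∷ A) (drop p) (skip p′) e
    (trans (cong (_+ 2 * count) (trans (hamming-++ ⊥ ⁅ w′ (2 ^ n) ⁆ (graph w T) (graph w′ T′))
                                       (cong (_+ hamming (graph w T) (graph w′ T′)) (hamming-⊥-⁅⁆ (w′ (2 ^ n))))))
           (trans (cong suc b) (sym (+-suc k l))))
  agreement-of {Q = Q} w w′ (out∷ T) (out∷ T′) with agreement-of w w′ T T′
  ... | agreement {count} A p p′ e b = agreement (out∷ A) (drop p) (drop p′) e
    (trans (cong (_+ 2 * count) (trans (hamming-++ (⊥ {Q}) ⊥ (graph w T) (graph w′ T′))
                                       (cong (_+ hamming (graph w T) (graph w′ T′)) (hamming-refl (⊥ {Q})))))
           b)

-- The algebraic code and its decoding from `r` common points.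

module Codewords where

  open import Data.Nat as ℕ using (ℕ; zero; suc; NonZero; _∸_; _^_)
  import Data.Nat.Properties as ℕ
  open import Data.Integer using (ℤ; +_; _+_; _-_; _*_; -_; 0ℤ; _%ℕ_)
  import Data.Integer.Properties as ℤ
  open import Data.Integer.DivMod using (n%ℕd<d)
  open import Data.Integer.Tactic.RingSolver using (solve-∀)
  open Polynomials
  open Subsets

  lookup-injective : ∀ {A : Set} {n} (u v : Vec A n) → (∀ i → lookup u i ≡ lookup v i) → u ≡ v
  lookup-injective []      []      h = refl
  lookup-injective (x ∷ u) (y ∷ v) h = cong₂ _∷_ (h zero) (lookup-injective u v (λ i → h (suc i)))

  module Codeword (M t r-1 W q : ℕ) .{{_ : NonZero q}} where

    open Congruence q

    r D m : ℕ
    r = suc r-1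
    D = (M ∸ r) C (t ∸ r)
    m = 2 ^ M

    Residues : ℕ → Set
    Residues = Vec (Fin q)

    -- The free data: node set and number, then for each of the `suc m` polynomials the `r-1` lowest
    -- coefficients, then `m` leading coefficients, the last one being fixed by `balanced`.
    Parameters : Set
    Parameters = (Choose M t × Fin W) × (Vec (Residues r-1) (suc m) × Residues m)

    residue : Fin q → ℤ
    residue i = + toℕ i

    -- When `s` is the code of an `r`-subset of `T`, this is a number with leading digit `j` and
    -- last digit the rank of `T` in base `D`.
    target : Choose M t → Fin W → ℕ → ℕ
    target T j s = D ℕ.* toℕ j ℕ.+ rank (decode M s) T

    leading : Residues m → Fin (suc m) → ℤ
    leading c = balanced (λ i → residue (lookup c i))

    subleading : Choose M t → Fin W → Residues m → Fin (suc m) → ℤ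
    subleading T j c s = + target T j (toℕ s) - + toℕ s * leading c s

    polynomial : Parameters → Fin (suc m) → ℤ → ℤ
    polynomial ((T , j) , (g , c)) s =
      eval (map residue (lookup g s)) (lin (subleading T j c s) (leading c s))

    -- The vector of `suc m` residues at a node is packed into a single index, as `graph` expects.
    word : Parameters → ℕ → Fin (q ^ suc m)
    word p x = funToFin (λ s → fromℕ< (n%ℕd<d (polynomial p s (+ x)) q))

    word-≡⇒Zero : ∀ p p′ x → word p x ≡ word p′ x → ∀ s →
      Zero (polynomial p s (+ x) - polynomial p′ s (+ x))
    word-≡⇒Zero p p′ x eq s = same-residue⇒Zero (polynomial p s (+ x)) (polynomial p′ s (+ x)) (begin
      u                                                    ≡⟨ Fin.toℕ-fromℕ< (n%ℕd<d (polynomial p s (+ x)) q) ⟨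
      toℕ (f s)                                            ≡⟨ cong toℕ (Fin.finToFun-funToFin f s) ⟨
      toℕ (finToFun (word p x) s)                          ≡⟨ cong (λ z → toℕ (finToFun z s)) eq ⟩
      toℕ (finToFun (word p′ x) s)                         ≡⟨ cong toℕ (Fin.finToFun-funToFin f′ s) ⟩
      toℕ (f′ s)                                           ≡⟨ Fin.toℕ-fromℕ< (n%ℕd<d (polynomial p′ s (+ x)) q) ⟩
      v                                                    ∎)
      where
      open ≡-Reasoning
      u = polynomial p s (+ x) %ℕ q
      v = polynomial p′ s (+ x) %ℕ q
      f f′ : Fin (suc m) → Fin q
      f s = fromℕ< (n%ℕd<d (polynomial p s (+ x)) q)
      f′ s = fromℕ< (n%ℕd<d (polynomial p′ s (+ x)) q)

    residue-injective : ∀ {i j} → Zero (residue i - residue j) → i ≡ j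
    residue-injective {i} {j} z = Fin.toℕ-injective (Zero⇒≡ (Fin.toℕ<n i) (Fin.toℕ<n j) z)

    residues-injective : ∀ {n} (u v : Residues n) →
      All Zero (zipWith _-_ (map residue u) (map residue v)) → u ≡ v
    residues-injective []      []      []       = refl
    residues-injective (i ∷ u) (j ∷ v) (z ∷ zs) = cong₂ _∷_ (residue-injective z) (residues-injective u v zs)

    target-as-combine : ∀ {R : Choose M r} {T} (j : Fin W) (R⊆T : R ⊆ T) →
      target T j (code R) ≡ toℕ (combine j (fromℕ< (rank-< R⊆T)))
    target-as-combine {R} {T} j R⊆T = begin
      D ℕ.* toℕ j ℕ.+ rank (decode M (code R)) T
        ≡⟨ cong (λ z → D ℕ.* toℕ j ℕ.+ rank z T) (decode-code R) ⟩
      D ℕ.* toℕ j ℕ.+ rank ⌊ R ⌋ T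
        ≡⟨ cong (D ℕ.* toℕ j ℕ.+_) (Fin.toℕ-fromℕ< (rank-< R⊆T)) ⟨
      D ℕ.* toℕ j ℕ.+ toℕ (fromℕ< (rank-< R⊆T))
        ≡⟨ Fin.toℕ-combine j (fromℕ< (rank-< R⊆T)) ⟨
      toℕ (combine j (fromℕ< (rank-< R⊆T))) ∎
      where open ≡-Reasoning

    module _ (W*D≤q : W ℕ.* D ℕ.≤ q)
             (separated : ∀ {x y} → y ℕ.≤ m → x ℕ.≤ m → x ≢ y → Separated x y) where

      -- Both targets lie below `W * D ≤ q`, so congruence is equality; the digits then give `j` and
      -- the rank, and the rank gives `T`.
      target-injective : ∀ {R : Choose M r} {T T′} {j j′} → R ⊆ T → R ⊆ T′ →
        Zero (+ target T j (code R) - + target T′ j′ (code R)) → T ≡ T′ × j ≡ j′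
      target-injective {R} {T} {T′} {j} {j′} p p′ z =
        rank-injective p p′ (begin
          rank ⌊ R ⌋ T               ≡⟨ Fin.toℕ-fromℕ< (rank-< p) ⟨
          toℕ (fromℕ< (rank-< p))    ≡⟨ cong toℕ (proj₂ both-equal) ⟩
          toℕ (fromℕ< (rank-< p′))   ≡⟨ Fin.toℕ-fromℕ< (rank-< p′) ⟩
          rank ⌊ R ⌋ T′              ∎)
        , proj₁ both-equal
        where
        open ≡-Reasoning
        both-equal : j ≡ j′ × fromℕ< (rank-< p) ≡ fromℕ< (rank-< p′)
        both-equal = Fin.combine-injective j _ j′ _ (Fin.toℕ-injective (Zero⇒≡
          (ℕ.<-≤-trans (Fin.toℕ<n (combine j (fromℕ< (rank-< p)))) W*D≤q)
          (ℕ.<-≤-trans (Fin.toℕ<n (combine j′ (fromℕ< (rank-< p′)))) W*D≤q)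
          (subst Zero (cong₂ (λ u v → + u - + v) (target-as-combine j p) (target-as-combine j′ p′)) z)))

      nodes-separated : (R : Choose M r) → AllPairs Separated (nodes R)
      nodes-separated R = AllPairs.map
        (λ (y<x , x<m) → separated (ℕ.<⇒≤ (ℕ.<-trans y<x x<m)) (ℕ.<⇒≤ x<m) (ℕ.>⇒≢ y<x))
        (nodes-distinct R)

      word-determines : ∀ {R : Choose M r} {T T′} (j j′ : Fin W) g g′ c c′ → R ⊆ T → R ⊆ T′ →
        All (λ x → word ((T , j) , (g , c)) x ≡ word ((T′ , j′) , (g′ , c′)) x) (nodes R) →
        _≡_ {A = Parameters} ((T , j) , (g , c)) ((T′ , j′) , (g′ , c′))
      word-determines {R} {T} {T′} j j′ g g′ c c′ p p′ agree = same-target (target-injective p p′ at-code)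
        where
        P P′ : Parameters
        P  = (T , j) , (g , c)
        P′ = (T′ , j′) , (g′ , c′)

        e : ℤ
        e = + code R

        δc δb : Fin (suc m) → ℤ
        δc s = leading c s - leading c′ s
        δb s = subleading T j c s - subleading T′ j′ c′ s

        δg : ∀ s → Vec ℤ r-1
        δg s = zipWith _-_ (map residue (lookup g s)) (map residue (lookup g′ s))

        roots : ∀ s → All (λ x → Zero (eval (δg s) (lin (δb s) (δc s)) (+ x))) (nodes R)
        roots s = All.map (λ {x} eq → subst Zero
            (sym (eval-difference (subleading T j c s) (subleading T′ j′ c′ s)
                   (leading c s) (leading c′ s)
                   (map residue (lookup g s)) (map residue (lookup g′ s)) (+ x)))
            (word-≡⇒Zero P P′ x eq s)) agree

        -- Vieta's relation for the differences, after the defining equation of `subleading` is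
        -- substituted.
        relation : ∀ s → Zero ((+ target T j (toℕ s) - + target T′ j′ (toℕ s)) + (e - + toℕ s) * δc s)
        relation s = subst Zero
          (identity (+ target T j (toℕ s)) (+ target T′ j′ (toℕ s)) (+ toℕ s) e (leading c s) (leading c′ s))
          (top-coefficients (δg s) (δb s) (δc s) (nodes R) (nodes-separated R) (roots s))
          where
          identity : ∀ a a′ s e c c′ →
            ((a - s * c) - (a′ - s * c′)) + e * (c - c′) ≡ (a - a′) + (e - s) * (c - c′)
          identity = solve-∀

        code<1+m : code R ℕ.< suc m
        code<1+m = ℕ.m<n⇒m<1+n (code<2^n R)

        -- The index equal to the node sum of `R`, where the factor `e - s` vanishes and only the
        -- targets remain.
        s₀ : Fin (suc m)
        s₀ = fromℕ< code<1+m

        at-code : Zero (+ target T j (code R) - + target T′ j′ (code R))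
        at-code = subst Zero (identity (+ target T j (code R) - + target T′ j′ (code R)) e (δc s₀))
          (subst (λ z → Zero ((+ target T j z - + target T′ j′ z) + (e - + z) * δc s₀))
                 (Fin.toℕ-fromℕ< code<1+m) (relation s₀))
          where
          identity : ∀ a e c → a + (e - e) * c ≡ a
          identity = solve-∀

        same-target : T ≡ T′ × j ≡ j′ → P ≡ P′
        same-target (refl , refl) = same-leading (lookup-injective c c′ λ i → residue-injective
          (balanced-all-but-one (λ i → residue (lookup c i)) (λ i → residue (lookup c′ i)) s₀ off-code i))
          where
          off-code : ∀ s → s ≢ s₀ → Zero (δc s)
          -- The targets cancel now that `T` and `j` agree, and `e - s` is a nonzero difference of
          -- numbers at most `m`, hence cancellable.
          off-code s s≢s₀ = separated (ℕ.<⇒≤ (code<2^n R)) (ℕ.≤-pred (Fin.toℕ<n s))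
            (λ eq → s≢s₀ (Fin.toℕ-injective (trans eq (sym (Fin.toℕ-fromℕ< code<1+m))))) _
            (subst Zero (identity (+ target T j (toℕ s)) ((e - + toℕ s) * δc s)) (relation s))
            where
            identity : ∀ a u → (a - a) + u ≡ u
            identity = solve-∀

          same-leading : c ≡ c′ → P ≡ P′
          same-leading refl = cong (λ g → (T , j) , (g , c)) (lookup-injective g g′ λ s →
            residues-injective (lookup g s) (lookup g′ s)
              (enough (δg s) (nodes R) (nodes-separated R)
                (All.map (λ {x} → subst Zero (eval-zero-tail (δg s)
                    (ℤ.+-inverseʳ (subleading T j c s)) (ℤ.+-inverseʳ (leading c s)) (+ x))) (roots s))))
            where
            enough : ∀ (g : Vec ℤ r-1) (xs : Vec ℕ r) → AllPairs Separated xs →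
              All (λ x → Zero (eval g (λ _ → 0ℤ) (+ x))) xs → All Zero g
            enough g (x ∷ xs) (_ ∷ ss) (_ ∷ zs) = enough-roots⇒zero g xs ss zs

-- Binomial identities and estimates of powers.

open import Data.Nat
open import Data.Nat.Properties
open import Data.Nat.Tactic.RingSolver using (solve-∀)
import Data.Nat as ℕ
import Data.Nat.Properties as ℕ
import Data.Integer as ℤ
import Data.Integer.Properties as ℤ
import Data.Integer.Tactic.RingSolver as ℤ
open import Data.Integer.Divisibility.Signed using (divides; ∣ᵤ⇒∣)
open Polynomials
open Subsets
open Codewords

absorption : ∀ n k → suc k * (suc n C suc k) ≡ suc n * (n C k)
absorption zero    zero    = refl
absorption zero    (suc k) = trans (cong (suc (suc k) *_) (k>n⇒nCk≡0 {1} {suc (suc k)} (s≤s (s≤s z≤n))))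
  (trans (*-zeroʳ (suc (suc k))) (sym (trans (+-identityʳ _) (k>n⇒nCk≡0 {0} {suc k} (s≤s z≤n)))))
absorption (suc n) zero    = begin
  1 * (suc (suc n) C 1)       ≡⟨ cong (1 *_) (nCk+nC[k+1]≡[n+1]C[k+1] (suc n) 0) ⟨
  1 * (1 + suc n C 1)         ≡⟨ *-distribˡ-+ 1 1 (suc n C 1) ⟩
  1 + 1 * (suc n C 1)         ≡⟨ cong suc (absorption n 0) ⟩
  suc (suc n) * 1             ∎
  where open ≡-Reasoning
absorption (suc n) (suc k) = begin
  suc (suc k) * (suc (suc n) C suc (suc k))
    ≡⟨ cong (suc (suc k) *_) (nCk+nC[k+1]≡[n+1]C[k+1] (suc n) (suc k)) ⟨
  suc (suc k) * (A + suc n C suc (suc k))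
    ≡⟨ regroup (suc k) A (suc n C suc (suc k)) ⟩
  A + (suc k * A + suc (suc k) * (suc n C suc (suc k)))
    ≡⟨ cong (A +_) (cong₂ _+_ (absorption n k) (absorption n (suc k))) ⟩
  A + (suc n * (n C k) + suc n * (n C suc k))
    ≡⟨ cong (A +_) (*-distribˡ-+ (suc n) (n C k) (n C suc k)) ⟨
  A + suc n * (n C k + n C suc k)
    ≡⟨ cong (λ z → A + suc n * z) (nCk+nC[k+1]≡[n+1]C[k+1] n k) ⟩
  suc (suc n) * A ∎
  where
  open ≡-Reasoning
  A = suc n C suc k
  regroup : ∀ j A B → suc j * (A + B) ≡ A + (j * A + suc j * B)
  regroup = solve-∀

-- Both sides count pairs of an `r`-set inside a `t`-set. After multiplication by `suc r`,
-- `absorption` removes one element throughout.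
trinomial : ∀ n t {r} → r ≤ t → (n C t) * (t C r) ≡ (n C r) * ((n ∸ r) C (t ∸ r))
trinomial n t z≤n = *-comm (n C t) 1
trinomial zero (suc t) {suc r} _ = begin
  (0 C suc t) * (suc t C suc r) ≡⟨ cong (_* (suc t C suc r)) (k>n⇒nCk≡0 {0} {suc t} (s≤s z≤n)) ⟩
  0                             ≡⟨ cong (_* (0 C (t ∸ r))) (k>n⇒nCk≡0 {0} {suc r} (s≤s z≤n)) ⟨
  (0 C suc r) * (0 C (t ∸ r))   ∎
  where open ≡-Reasoning
trinomial (suc n) (suc t) {suc r} (s≤s r≤t) = *-cancelˡ-≡ _ _ (suc r) (begin
  suc r * ((suc n C suc t) * (suc t C suc r))   ≡⟨ swap (suc r) (suc n C suc t) (suc t C suc r) ⟩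
  (suc n C suc t) * (suc r * (suc t C suc r))   ≡⟨ cong ((suc n C suc t) *_) (absorption t r) ⟩
  (suc n C suc t) * (suc t * (t C r))           ≡⟨ swap′ (suc n C suc t) (suc t) (t C r) ⟩
  (suc t * (suc n C suc t)) * (t C r)           ≡⟨ cong (_* (t C r)) (absorption n t) ⟩
  suc n * (n C t) * (t C r)                     ≡⟨ *-assoc (suc n) (n C t) (t C r) ⟩
  suc n * ((n C t) * (t C r))                   ≡⟨ cong (suc n *_) (trinomial n t r≤t) ⟩
  suc n * ((n C r) * X)                         ≡⟨ *-assoc (suc n) (n C r) X ⟨
  suc n * (n C r) * X                           ≡⟨ cong (_* X) (absorption n r) ⟨
  suc r * (suc n C suc r) * X                   ≡⟨ *-assoc (suc r) (suc n C suc r) X ⟩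
  suc r * ((suc n C suc r) * X)                 ∎)
  where
  open ≡-Reasoning
  X = (n ∸ r) C (t ∸ r)
  swap : ∀ a b c → a * (b * c) ≡ b * (a * c)
  swap = solve-∀
  swap′ : ∀ a b c → a * (b * c) ≡ (b * a) * c
  swap′ = solve-∀

private
  -- The recursion of the falling factorial `k ! * (n C k)`; the two power bounds below estimate it
  -- factor by factor.
  !-absorption : ∀ n k → suc k ! * (suc n C suc k) ≡ suc n * (k ! * (n C k))
  !-absorption n k = begin
    suc k * k ! * (suc n C suc k)     ≡⟨ assoc (suc k) (k !) (suc n C suc k) ⟩
    k ! * (suc k * (suc n C suc k))   ≡⟨ cong (k ! *_) (absorption n k) ⟩
    k ! * (suc n * (n C k))           ≡⟨ assoc′ (k !) (suc n) (n C k) ⟩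
    suc n * (k ! * (n C k))           ∎
    where
    open ≡-Reasoning
    assoc : ∀ a b c → a * b * c ≡ b * (a * c)
    assoc = solve-∀
    assoc′ : ∀ a b c → a * (b * c) ≡ b * (a * c)
    assoc′ = solve-∀

k!*nCk≤n^k : ∀ n k → k ! * (n C k) ≤ n ^ k
k!*nCk≤n^k n       zero    = ≤-refl
k!*nCk≤n^k zero    (suc k) = ≤-reflexive (trans
  (cong (suc k ! *_) (k>n⇒nCk≡0 {0} {suc k} (s≤s z≤n))) (*-zeroʳ (suc k !)))
k!*nCk≤n^k (suc n) (suc k) = begin
  suc k ! * (suc n C suc k)  ≡⟨ !-absorption n k ⟩
  suc n * (k ! * (n C k))    ≤⟨ *-monoʳ-≤ (suc n) (k!*nCk≤n^k n k) ⟩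
  suc n * n ^ k              ≤⟨ *-monoʳ-≤ (suc n) (^-monoˡ-≤ k (n≤1+n n)) ⟩
  suc n ^ suc k              ∎
  where open ≤-Reasoning

[n∸k]^k≤k!*nCk : ∀ n k → (n ∸ k) ^ k ≤ k ! * (n C k)
[n∸k]^k≤k!*nCk n       zero    = ≤-refl
[n∸k]^k≤k!*nCk zero    (suc k) = z≤n
[n∸k]^k≤k!*nCk (suc n) (suc k) = begin
  (n ∸ k) * (n ∸ k) ^ k      ≤⟨ *-mono-≤ (m≤n⇒m≤1+n (m∸n≤m n k)) ([n∸k]^k≤k!*nCk n k) ⟩
  suc n * (k ! * (n C k))    ≡⟨ !-absorption n k ⟨
  suc k ! * (suc n C suc k)  ∎
  where open ≤-Reasoning

-- (1 - b / (y + b)) ^ p ≥ 1 - p b / (y + b), cleared of denominators.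
bernoulli : ∀ y b p → (y + b) * (y + b) ^ p ≤ (y + b) * y ^ p + p * b * (y + b) ^ p
bernoulli y b zero    = m≤m+n _ _
bernoulli y b (suc p) = begin
  a * (a * a ^ p)                                     ≡⟨ step₁ y b (a ^ p) ⟩
  y * (a * a ^ p) + b * (a * a ^ p)                   ≤⟨ +-monoˡ-≤ _ (*-monoʳ-≤ y (bernoulli y b p)) ⟩
  y * (a * y ^ p + p * b * a ^ p) + b * (a * a ^ p)   ≡⟨ step₂ y b p (a ^ p) (y ^ p) ⟩
  a * (y * y ^ p) + (y * (p * b * a ^ p) + b * (a * a ^ p))
    ≤⟨ +-monoʳ-≤ (a * (y * y ^ p)) (+-monoˡ-≤ _ (*-monoˡ-≤ (p * b * a ^ p) (m≤m+n y b))) ⟩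
  a * (y * y ^ p) + (a * (p * b * a ^ p) + b * (a * a ^ p))
    ≡⟨ step₃ a b p (a ^ p) (y * y ^ p) ⟩
  a * (y * y ^ p) + (b + p * b) * (a * a ^ p)         ∎
  where
  open ≤-Reasoning
  a = y + b
  step₁ : ∀ y b A → (y + b) * ((y + b) * A) ≡ y * ((y + b) * A) + b * ((y + b) * A)
  step₁ = solve-∀
  step₂ : ∀ y b p A Y → y * ((y + b) * Y + p * b * A) + b * ((y + b) * A)
        ≡ (y + b) * (y * Y) + (y * (p * b * A) + b * ((y + b) * A))
  step₂ = solve-∀
  step₃ : ∀ a b p A Y → a * Y + (a * (p * b * A) + b * (a * A)) ≡ a * Y + (b + p * b) * (a * A)
  step₃ = solve-∀

-- The hypothesis makes the relative loss in `bernoulli` at most `1 / suc κ`.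
near-power : ∀ κ y b p .{{_ : NonZero (y + b)}} → suc κ * (p * b) ≤ y + b →
  κ * (y + b) ^ p ≤ suc κ * y ^ p
near-power κ y b p h = *-cancelˡ-≤ a (+-cancelʳ-≤ (a * A) _ _ (begin
  a * (κ * A) + a * A                        ≡⟨ step₁ a κ A ⟩
  suc κ * (a * A)                            ≤⟨ *-monoʳ-≤ (suc κ) (bernoulli y b p) ⟩
  suc κ * (a * Y + p * b * A)                ≡⟨ step₂ (suc κ) a Y (p * b) A ⟩
  a * (suc κ * Y) + suc κ * (p * b) * A      ≤⟨ +-monoʳ-≤ (a * (suc κ * Y)) (*-monoˡ-≤ A h) ⟩
  a * (suc κ * Y) + a * A                    ∎))
  where
  open ≤-Reasoning
  a = y + b
  A = a ^ p
  Y = y ^ p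
  step₁ : ∀ a κ A → a * (κ * A) + a * A ≡ suc κ * (a * A)
  step₁ = solve-∀
  step₂ : ∀ k a Y c A → k * (a * Y + c * A) ≡ a * (k * Y) + k * c * A
  step₂ = solve-∀

-- Two losses of `1 / (2 κ + 2)` combine to at most `1 / (κ + 1)`, because
-- `4 κ (κ + 1) + 1 = (2 κ + 1)²`.
near-product : ∀ κ a a′ b b′ → let κ₂ = suc (2 * κ) in
  κ₂ * a ≤ suc κ₂ * a′ → κ₂ * b ≤ suc κ₂ * b′ → κ * (a * b) ≤ suc κ * (a′ * b′)
near-product κ a a′ b b′ h h′ = *-cancelˡ-≤ (4 * suc κ) (begin
  4 * suc κ * (κ * (a * b))                             ≤⟨ m≤m+n _ (a * b) ⟩
  4 * suc κ * (κ * (a * b)) + a * b                     ≡⟨ step₁ κ a b ⟩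
  (suc (2 * κ) * a) * (suc (2 * κ) * b)                 ≤⟨ *-mono-≤ h h′ ⟩
  (suc (suc (2 * κ)) * a′) * (suc (suc (2 * κ)) * b′)   ≡⟨ step₂ κ a′ b′ ⟩
  4 * suc κ * (suc κ * (a′ * b′))                       ∎)
  where
  open ≤-Reasoning
  step₁ : ∀ κ a b → 4 * suc κ * (κ * (a * b)) + a * b ≡ (suc (2 * κ) * a) * (suc (2 * κ) * b)
  step₁ = solve-∀
  step₂ : ∀ κ a b → (suc (suc (2 * κ)) * a) * (suc (suc (2 * κ)) * b) ≡ 4 * suc κ * (suc κ * (a * b))
  step₂ = solve-∀

-- Upward search from `k` for the first step that crosses `n`, with `d` bounding the number of
-- steps.
bracket : ∀ (f : ℕ → ℕ) {n} d k → f k ≤ n → n < f (d + k) →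
  ∃[ j ] (k ≤ j × f j ≤ n × n < f (suc j))
bracket f zero    k fk≤n n<fk = contradiction fk≤n (<⇒≱ n<fk)
bracket f {n} (suc d) k fk≤n n<f with f (suc k) ≤? n
... | no  h = k , ≤-refl , fk≤n , ≰⇒> h
... | yes h = let j , k<j , h₁ , h₂ = bracket f d (suc k) h (subst (λ z → n < f z) (sym (+-suc d k)) n<f)
              in j , <⇒≤ k<j , h₁ , h₂

-- Enumeration of parameters and regularity of differences.

length-cartesianProductWith : ∀ {A B X : Set} (f : A → B → X) xs ys →
  length (cartesianProductWith f xs ys) ≡ length xs * length ys
length-cartesianProductWith f []       ys = refl
length-cartesianProductWith f (x ∷ xs) ys = trans (length-++ (List.map (f x) ys))
  (cong₂ _+_ (length-map (f x) ys) (length-cartesianProductWith f xs ys))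

vectors : ∀ {A : Set} → List A → ∀ k → List (Vec A k)
vectors xs zero    = [] ∷ []
vectors xs (suc k) = cartesianProductWith _∷_ xs (vectors xs k)

length-vectors : ∀ {A : Set} (xs : List A) k → length (vectors xs k) ≡ length xs ^ k
length-vectors xs zero    = refl
length-vectors xs (suc k) =
  trans (length-cartesianProductWith _∷_ xs (vectors xs k)) (cong (length xs *_) (length-vectors xs k))

vectors-unique : ∀ {A : Set} {xs : List A} → Unique xs → ∀ k → Unique (vectors xs k)
vectors-unique u zero    = [] ∷ []
vectors-unique u (suc k) = Unique.cartesianProductWith⁺ _∷_ (λ { refl → refl , refl }) u (vectors-unique u k)

-- q ≡ 1 modulo every nonzero difference x - y, which is therefore a unit modulo q.
separated : ∀ B D k {x y} → y ≤ B → x ≤ B → x ≢ y →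
  Congruence.Separated (suc (k * (B ! * D))) x y
separated B D k {x} {y} y≤B x≤B x≢y z (divides u eq) with
  ∣ᵤ⇒∣ {ℤ.+ y ℤ.- ℤ.+ x} {ℤ.+ (k * (B ! * D))} (ℕ.∣n⇒∣m*n k (ℕ.∣m⇒∣m*n D (divides-factorial _ bound nonzero)))
  where
  divides-factorial : ∀ d → d ≤ B → d ≢ 0 → d ℕ.∣ B !
  divides-factorial zero    _   d≢0 = contradiction refl d≢0
  divides-factorial (suc d) d≤B _   = ℕ.∣-trans (ℕ.∣m⇒∣m*n (d !) ℕ.∣-refl) (ℕ.m≤n⇒m!∣n! d≤B)
  bound : ℤ.∣ ℤ.+ y ℤ.- ℤ.+ x ∣ ≤ B
  bound = ≤-trans (subst (_≤ y ⊔ x) (cong ℤ.∣_∣ (sym (ℤ.m-n≡m⊖n y x))) (ℤ.∣m⊝n∣≤m⊔n y x)) (⊔-lub y≤B x≤B)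
  nonzero : ℤ.∣ ℤ.+ y ℤ.- ℤ.+ x ∣ ≢ 0
  nonzero h = x≢y (sym (ℤ.+-injective (ℤ.i-j≡0⇒i≡j (ℤ.+ y) (ℤ.+ x) (ℤ.∣i∣≡0⇒i≡0 h))))
-- With `q = 1 + N` and `N = v * d`, the number `- v` is an inverse of `d` modulo `q`.
... | divides v eq′ = divides (z ℤ.- v ℤ.* u) (begin
  z
    ≡⟨ step₁ z (ℤ.+ N) ⟩
  z ℤ.* (ℤ.1ℤ ℤ.+ ℤ.+ N) ℤ.- ℤ.+ N ℤ.* z
    ≡⟨ cong (λ w → z ℤ.* (ℤ.1ℤ ℤ.+ ℤ.+ N) ℤ.- w ℤ.* z) eq′ ⟩
  z ℤ.* (ℤ.1ℤ ℤ.+ ℤ.+ N) ℤ.- v ℤ.* d ℤ.* z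
    ≡⟨ cong (λ w → z ℤ.* (ℤ.1ℤ ℤ.+ ℤ.+ N) ℤ.- w) (trans (ℤ.*-assoc v d z) (cong (v ℤ.*_) eq)) ⟩
  z ℤ.* (ℤ.1ℤ ℤ.+ ℤ.+ N) ℤ.- v ℤ.* (u ℤ.* (ℤ.1ℤ ℤ.+ ℤ.+ N))
    ≡⟨ step₂ z v u (ℤ.1ℤ ℤ.+ ℤ.+ N) ⟩
  (z ℤ.- v ℤ.* u) ℤ.* (ℤ.1ℤ ℤ.+ ℤ.+ N) ∎)
  where
  open ≡-Reasoning
  N = k * (B ! * D)
  d = ℤ.+ y ℤ.- ℤ.+ x
  step₁ : ∀ z N → z ≡ z ℤ.* (ℤ.1ℤ ℤ.+ N) ℤ.- N ℤ.* z
  step₁ = ℤ.solve-∀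
  step₂ : ∀ z v u q → z ℤ.* q ℤ.- v ℤ.* (u ℤ.* q) ≡ (z ℤ.- v ℤ.* u) ℤ.* q
  step₂ = ℤ.solve-∀

-- The family for given `M` and `k`: distances and size.

module Family (M r-1 s k : ℕ) where

  -- `W` is chosen so that `W * D = k * L = q - 1`: the targets at a code exhaust all residues but
  -- one.
  r t D L q W : ℕ
  r = suc r-1
  t = r + s
  D = (M ∸ r) C (t ∸ r)
  L = (2 ^ M) ! * D
  q = suc (k * L)
  W = k * (2 ^ M) !

  open Codeword M t r-1 W q hiding (r; D)

  W*D≡ : W * D ≡ k * L
  W*D≡ = *-assoc k ((2 ^ M) !) D

  parameters : List Parameters
  parameters = cartesianProduct (cartesianProduct (allChoose M t) (allFin W))
    (cartesianProduct (vectors (vectors (allFin q) r-1) (suc m)) (vectors (allFin q) m))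

  parameters-unique : Unique parameters
  parameters-unique = Unique.cartesianProduct⁺
    (Unique.cartesianProduct⁺ (allChoose-unique M t) (Unique.allFin⁺ W))
    (Unique.cartesianProduct⁺ (vectors-unique (vectors-unique (Unique.allFin⁺ q) r-1) (suc m))
                              (vectors-unique (Unique.allFin⁺ q) m))

  length-parameters : length parameters ≡ ((M C t) * W) * ((q ^ r-1) ^ suc m * q ^ m)
  length-parameters = begin
    length parameters
      ≡⟨ length-cartesianProductWith _,_ (cartesianProduct (allChoose M t) (allFin W)) _ ⟩
    length (cartesianProduct (allChoose M t) (allFin W)) *
    length (cartesianProduct (vectors (vectors (allFin q) r-1) (suc m)) (vectors (allFin q) m))
      ≡⟨ cong₂ _*_ (length-cartesianProductWith _,_ (allChoose M t) (allFin W))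
                   (length-cartesianProductWith _,_ (vectors (vectors (allFin q) r-1) (suc m)) _) ⟩
    (length (allChoose M t) * length (allFin W)) *
    (length (vectors (vectors (allFin q) r-1) (suc m)) * length (vectors (allFin q) m))
      ≡⟨ cong₂ _*_ (cong₂ _*_ (length-allChoose M t) (length-tabulate {n = W} (λ i → i)))
                   (cong₂ _*_ (trans (length-vectors (vectors (allFin q) r-1) (suc m))
                                     (cong (_^ suc m) (length-residues r-1)))
                              (length-residues m)) ⟩
    ((M C t) * W) * ((q ^ r-1) ^ suc m * q ^ m) ∎
    where
    open ≡-Reasoning
    length-residues : ∀ n → length (vectors (allFin q) n) ≡ q ^ n
    length-residues n = trans (length-vectors (allFin q) n) (cong (_^ n) (length-tabulate {n = q} (λ i → i)))

  unpadded : Parameters → Vec Bool (M * q ^ suc m)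
  unpadded p = graph (word p) (proj₁ (proj₁ p))

  -- Padding by `o` zeros reaches lengths not of the form `M * q ^ suc m` and leaves distances
  -- unchanged.
  block : ∀ o → Parameters → Vec Bool (M * q ^ suc m + o)
  block o p = unpadded p ++ ⊥ {o}

  hamming-block : ∀ o p p′ → hamming (block o p) (block o p′) ≡ hamming (unpadded p) (unpadded p′)
  hamming-block o p p′ = trans (hamming-++ (unpadded p) (unpadded p′) (⊥ {o}) (⊥ {o}))
    (trans (cong (hamming (unpadded p) (unpadded p′) +_) (hamming-refl (⊥ {o}))) (+-identityʳ _))

  -- The distance is `2 * t - 2 * count` with `t = r + s`, so distance at most `2 * s` forces `r`
  -- common points, and these determine the parameters.
  near⇒≡ : ∀ o p p′ → hamming (block o p) (block o p′) ≤ 2 * s → p ≡ p′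
  near⇒≡ o p@((T , j) , (g , c)) p′@((T′ , j′) , (g′ , c′)) near
    with agreement-of (word p) (word p′) T T′
  ... | agreement {count} A A⊆T A⊆T′ agree balance with r ≤? count
  ... | yes r≤count = let R , R⊆A = shrink r≤count A in
    word-determines (≤-trans (≤-reflexive W*D≡) (n≤1+n (k * L)))
      (separated (2 ^ M) D k) j j′ g g′ c c′ (⊆-trans R⊆A A⊆T) (⊆-trans R⊆A A⊆T′) (nodes-⊆ R⊆A agree)
  ... | no r≰count = contradiction (begin-strict
      hamming (graph (word p) T) (graph (word p′) T′) + 2 * count
        ≤⟨ +-monoˡ-≤ (2 * count) (≤-trans (≤-reflexive (sym (hamming-block o p p′))) near) ⟩
      2 * s + 2 * count    <⟨ +-monoʳ-< (2 * s) (*-monoʳ-< 2 (≰⇒> r≰count)) ⟩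
      2 * s + 2 * r        ≡⟨ identity s r ⟩
      t + t                ≡⟨ balance ⟨
      hamming (graph (word p) T) (graph (word p′) T′) + 2 * count ∎)
    (<-irrefl refl)
    where
    open ≤-Reasoning
    identity : ∀ s r → 2 * s + 2 * r ≡ (r + s) + (r + s)
    identity = solve-∀

  hamming-block≤ : ∀ o p p′ → hamming (block o p) (block o p′) ≤ 2 * t
  hamming-block≤ o p@((T , _) , _) p′@((T′ , _) , _) with agreement-of (word p) (word p′) T T′
  ... | agreement {count} _ _ _ _ balance = begin
    hamming (block o p) (block o p′)                             ≡⟨ hamming-block o p p′ ⟩
    hamming (graph (word p) T) (graph (word p′) T′)              ≤⟨ m≤m+n _ (2 * count) ⟩
    hamming (graph (word p) T) (graph (word p′) T′) + 2 * count  ≡⟨ balance ⟩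
    t + t                                                        ≡⟨ cong (t +_) (+-identityʳ t) ⟨
    2 * t                                                        ∎
    where open ≤-Reasoning

  family : ∀ o → List (Vec Bool (M * q ^ suc m + o))
  family o = List.map (block o) parameters

  family-unique : ∀ o → Unique (family o)
  family-unique o = Unique.map⁺
    (λ {p} {p′} eq → near⇒≡ o p p′
      (≤-trans (≤-reflexive (trans (cong (λ z → hamming z (block o p′)) eq) (hamming-refl (block o p′)))) z≤n))
    parameters-unique

  family-distances : ∀ o x y → x ∈ family o → y ∈ family o → x ≢ y →
    (2 * s < hamming x y) × (hamming x y ≤ 2 * t)
  family-distances o x y x∈ y∈ x≢y with ∈-map⁻ (block o) x∈ | ∈-map⁻ (block o) y∈
  ... | p , _ , refl | p′ , _ , refl =
    ≰⇒> (λ near → x≢y (cong (block o) (near⇒≡ o p p′ near))) , hamming-block≤ o p p′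

  -- The factor `t C r` lets `trinomial` trade `M C t` for `(M C r) * D`, and `D` then merges with
  -- `W` into `k * L`.
  length-family : ∀ o → length (family o) * (t C r) ≡ (M C r) * (k * L * q ^ (r-1 * suc m + m))
  length-family o = begin
    length (family o) * (t C r)
      ≡⟨ cong (_* (t C r)) (trans (length-map (block o) parameters) length-parameters) ⟩
    ((M C t) * W) * ((q ^ r-1) ^ suc m * q ^ m) * (t C r)
      ≡⟨ cong (λ z → ((M C t) * W) * z * (t C r))
              (trans (cong (_* q ^ m) (^-*-assoc q r-1 (suc m))) (sym (^-distribˡ-+-* q (r-1 * suc m) m))) ⟩
    ((M C t) * W) * X * (t C r)          ≡⟨ step₁ (M C t) W X (t C r) ⟩
    ((M C t) * (t C r)) * (W * X)        ≡⟨ cong (_* (W * X)) (trinomial M t (m≤m+n r s)) ⟩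
    ((M C r) * D) * (W * X)              ≡⟨ step₂ (M C r) D W X ⟩
    (M C r) * ((W * D) * X)              ≡⟨ cong (λ z → (M C r) * (z * X)) W*D≡ ⟩
    (M C r) * (k * L * X)                ∎
    where
    open ≡-Reasoning
    X = q ^ (r-1 * suc m + m)
    step₁ : ∀ a w x b → (a * w) * x * b ≡ (a * b) * (w * x)
    step₁ = solve-∀
    step₂ : ∀ c d w x → (c * d) * (w * x) ≡ c * ((w * d) * x)
    step₂ = solve-∀

-- Packings of density close to one for every large `n`.

C-positive : ∀ {n k} → k ≤ n → 0 < n C k
C-positive z≤n = s≤s z≤n
C-positive {suc n} {suc k} (s≤s k≤n) = begin-strict
  0                   <⟨ C-positive k≤n ⟩
  n C k               ≤⟨ m≤m+n (n C k) (n C suc k) ⟩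
  n C k + n C suc k   ≡⟨ nCk+nC[k+1]≡[n+1]C[k+1] n k ⟩
  suc n C suc k       ∎
  where open ≤-Reasoning

^-distribʳ-* : ∀ k m n → (m * n) ^ k ≡ m ^ k * n ^ k
^-distribʳ-* zero    m n = refl
^-distribʳ-* (suc k) m n = trans (cong (m * n *_) (^-distribʳ-* k m n)) (interchange m n (m ^ k) (n ^ k))
  where
  interchange : ∀ a b c d → a * b * (c * d) ≡ a * c * (b * d)
  interchange = solve-∀

-- `dense` is the size bound with relative loss `1 / suc κ`, cleared of denominators.
record Packing (t s κ n : ℕ) : Set where
  field
    words     : List (Vec Bool n)
    unique    : Unique words
    distances : ∀ x y → x ∈ words → y ∈ words → x ≢ y → (2 * s < hamming x y) × (hamming x y ≤ 2 * t)
    dense     : κ * (n C (t ∸ s)) ≤ suc κ * (length words * (t C s))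

module Asymptotics (r-1 s κ : ℕ) where

  -- M ≥ κ₂ r² makes almost all r-sets of points meet r different nodes, and
  -- k ≥ k₀ makes the ground sets for k and k + 1 almost equally large.
  r t κ₂ y M m e L k₀ : ℕ
  r  = suc r-1
  t  = r + s
  κ₂ = suc (2 * κ)
  y  = suc κ₂ * (r * r) + s
  M  = y + r
  m  = 2 ^ M
  e  = r-1 * suc m + m
  L  = (2 ^ M) ! * ((M ∸ r) C (t ∸ r))
  k₀ = suc κ₂ * (suc e * suc L)

  points : ℕ → ℕ
  points k = M * suc (k * L) ^ suc m

  instance
    M≢0 : NonZero M
    M≢0 = >-nonZero (≤-trans (s≤s z≤n) (m≤n+m r y))

  -- The summand `s` in `y` ensures `M ∸ r ≥ t ∸ r`, so that the binomial factor is positive.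
  0<L : 0 < L
  0<L = *-mono-≤ (>-nonZero⁻¹ ((2 ^ M) !) ⦃ (2 ^ M) !≢0 ⦄)
    (C-positive (subst₂ _≤_ (sym (m+n∸m≡n r s)) (sym (m+n∸n≡m y r)) (m≤n+m s (suc κ₂ * (r * r)))))

  k<points : ∀ k → k < points k
  k<points k = begin-strict
    k                            ≡⟨ *-identityʳ k ⟨
    k * 1                        ≤⟨ *-monoʳ-≤ k 0<L ⟩
    k * L                        <⟨ n<1+n (k * L) ⟩
    suc (k * L)                  ≤⟨ m≤m*n (suc (k * L)) (suc (k * L) ^ m) ⦃ m^n≢0 (suc (k * L)) m ⦄ ⟩
    suc (k * L) ^ suc m          ≤⟨ m≤n*m (suc (k * L) ^ suc m) M ⟩
    points k                     ∎
    where open ≤-Reasoning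

  module _ {n k : ℕ} (k₀≤k : k₀ ≤ k) (n<points : n < points (suc k)) where

    -- The modulus belonging to `suc k`, split as `k * L` plus a constant to fit `near-power`.
    u : ℕ
    u = k * L + suc L

    instance
      u≢0 : NonZero u
      u≢0 = >-nonZero (≤-trans (s≤s z≤n) (m≤n+m (suc L) (k * L)))

    u≡ : suc (suc k * L) ≡ u
    u≡ = trans (cong suc (+-comm L (k * L))) (sym (+-suc (k * L) L))

    n^r≤ : n ^ r ≤ M ^ r * u ^ suc e
    n^r≤ = begin
      n ^ r                          ≤⟨ ^-monoˡ-≤ r (<⇒≤ n<points) ⟩
      points (suc k) ^ r             ≡⟨ cong (λ z → (M * z ^ suc m) ^ r) u≡ ⟩
      (M * u ^ suc m) ^ r            ≡⟨ ^-distribʳ-* r M (u ^ suc m) ⟩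
      M ^ r * (u ^ suc m) ^ r        ≡⟨ cong (M ^ r *_) (^-*-assoc u (suc m) r) ⟩
      M ^ r * u ^ (suc m * r)        ≡⟨ cong (λ z → M ^ r * u ^ z) (exponent m r-1) ⟩
      M ^ r * u ^ suc e              ∎
      where
      open ≤-Reasoning
      exponent : ∀ m r-1 → suc m * suc r-1 ≡ suc (r-1 * suc m + m)
      exponent = solve-∀

    near-M : κ₂ * M ^ r ≤ suc κ₂ * y ^ r
    near-M = near-power κ₂ y r r (≤-trans (m≤m+n _ s) (m≤m+n y r))

    near-u : κ₂ * u ^ suc e ≤ suc κ₂ * (k * L) ^ suc e
    near-u = near-power κ₂ (k * L) (suc L) (suc e) (begin
      k₀             ≤⟨ k₀≤k ⟩
      k              ≡⟨ *-identityʳ k ⟨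
      k * 1          ≤⟨ *-monoʳ-≤ k 0<L ⟩
      k * L          ≤⟨ m≤m+n (k * L) (suc L) ⟩
      u              ∎)
      where open ≤-Reasoning

    y^r≤ : y ^ r ≤ r ! * (M C r)
    y^r≤ = subst (λ z → z ^ r ≤ r ! * (M C r)) (m+n∸n≡m y r) ([n∸k]^k≤k!*nCk M r)

    -- Up to the factor `r !`, the left binomial is at most `(M * u ^ suc m) ^ r`. Replacing `M` by
    -- `y` and `u` by `k * L` costs `1 / suc κ₂` each, and `y ^ r` is at most `r ! * (M C r)`.
    count : κ * (n C r) ≤ suc κ * ((M C r) * (k * L * suc (k * L) ^ e))
    count = *-cancelˡ-≤ (r !) ⦃ r !≢0 ⦄ (begin
      r ! * (κ * (n C r))                              ≡⟨ swap (r !) κ (n C r) ⟩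
      κ * (r ! * (n C r))                              ≤⟨ *-monoʳ-≤ κ (≤-trans (k!*nCk≤n^k n r) n^r≤) ⟩
      κ * (M ^ r * u ^ suc e)
        ≤⟨ near-product κ (M ^ r) (y ^ r) (u ^ suc e) ((k * L) ^ suc e) near-M near-u ⟩
      suc κ * (y ^ r * (k * L) ^ suc e)
        ≤⟨ *-monoʳ-≤ (suc κ) (*-mono-≤ y^r≤ (*-monoʳ-≤ (k * L) (^-monoˡ-≤ e (n≤1+n (k * L))))) ⟩
      suc κ * (r ! * (M C r) * (k * L * suc (k * L) ^ e))
        ≡⟨ regroup (suc κ) (r !) (M C r) (k * L * suc (k * L) ^ e) ⟩
      r ! * (suc κ * ((M C r) * (k * L * suc (k * L) ^ e))) ∎)
      where
      open ≤-Reasoning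
      swap : ∀ a b c → a * (b * c) ≡ b * (a * c)
      swap = solve-∀
      regroup : ∀ a b c d → a * (b * c * d) ≡ b * (a * (c * d))
      regroup = solve-∀

  packing : ∀ n → points k₀ ≤ n → Packing t s κ n
  -- `points` exceeds its argument, so the search from `k₀` ends within `n` steps; the remainder `o`
  -- becomes padding.
  packing n N≤n with bracket points n k₀ N≤n
    (<-≤-trans (s≤s (m≤m+n n k₀)) (k<points (n + k₀)))
  ... | k , k₀≤k , points≤n , n<points with m≤n⇒∃[o]m+o≡n points≤n
  ... | o , refl = record
    { words     = family o
    ; unique    = family-unique o
    ; distances = family-distances o
    ; dense     = begin
        κ * ((points k + o) C (t ∸ s))    ≡⟨ cong (λ z → κ * ((points k + o) C z)) (m+n∸n≡m r s) ⟩
        κ * ((points k + o) C r)          ≤⟨ count k₀≤k n<points ⟩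
        suc κ * ((M C r) * (k * L * suc (k * L) ^ e))  ≡⟨ cong (suc κ *_) (length-family o) ⟨
        suc κ * (length (family o) * (t C r))
          ≡⟨ cong (λ z → suc κ * (length (family o) * (t C z))) (m+n∸n≡m r s) ⟨
        suc κ * (length (family o) * (t C (t ∸ s)))
          ≡⟨ cong (λ z → suc κ * (length (family o) * z)) (nCk≡nC[n∸k] (m≤n+m s r)) ⟨
        suc κ * (length (family o) * (t C s)) ∎
    }
    where
    open ≤-Reasoning
    open Family M r-1 s k using (family; family-unique; family-distances; length-family)

packing : ∀ {t s} → s < t → ∀ κ → ∃[ N ] (∀ n → N ≤ n → Packing t s κ n)
packing {t} {s} s<t κ with m≤n⇒∃[o]m+o≡n s<t
... | r-1 , refl rewrite +-comm s r-1 = _ , Asymptotics.packing r-1 s κ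

-- Passage to rational numbers and choice of the error function.

open import Data.Integer using (ℤ; +_; -[1+_]; 1ℤ)
open import Data.Rational using (ℚ; _-_) renaming (_*_ to _*ℚ_; _≤_ to _≤ℚ_)
open import Data.Rational as ℚ using (mkℚ; 0ℚ; toℚᵘ; *<*)
import Data.Rational.Properties as ℚ
open import Data.Rational.Unnormalised as ℚᵘ using (mkℚᵘ; *≤*; *<*)
import Data.Rational.Unnormalised.Properties as ℚᵘ

toℚᵘ-/ : ∀ i d-1 → toℚᵘ (i ℚ./ suc d-1) ℚᵘ.≃ mkℚᵘ i d-1
toℚᵘ-/ i d-1 = ℚ.toℚᵘ-fromℚᵘ (mkℚᵘ i d-1)

-- The hypothesis bounds `Y` below by `X / c - X / (c * suc κ)`, and the subtracted term is at most
-- `X / suc κ` since `c ≥ 1`.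
recipℕ-difference-≤ : ∀ c κ X Y .{{_ : NonZero c}} → κ ℕ.* X ℕ.≤ suc κ ℕ.* (Y ℕ.* c) →
  (recipℕ c ℚ.- recipℕ (suc κ)) ℚ.* (+ X ℚ./ 1) ℚ.≤ + Y ℚ./ 1
recipℕ-difference-≤ (suc c-1) κ X Y h = ℚ.toℚᵘ-cancel-≤ (begin
  toℚᵘ ((recipℕ (suc c-1) ℚ.- recipℕ (suc κ)) ℚ.* (+ X ℚ./ 1))
    ≃⟨ ℚ.toℚᵘ-homo-* (recipℕ (suc c-1) ℚ.- recipℕ (suc κ)) (+ X ℚ./ 1) ⟩
  toℚᵘ (recipℕ (suc c-1) ℚ.- recipℕ (suc κ)) ℚᵘ.* toℚᵘ (+ X ℚ./ 1)
    ≃⟨ ℚᵘ.*-cong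
         (ℚᵘ.≃-trans (ℚ.toℚᵘ-homo-+ (recipℕ (suc c-1)) (ℚ.- recipℕ (suc κ)))
           (ℚᵘ.+-cong (toℚᵘ-/ 1ℤ c-1)
             (ℚᵘ.≃-trans (ℚ.toℚᵘ-homo‿- (recipℕ (suc κ))) (ℚᵘ.-‿cong (toℚᵘ-/ 1ℤ κ)))))
         (toℚᵘ-/ (+ X) 0) ⟩
  (mkℚᵘ 1ℤ c-1 ℚᵘ.- mkℚᵘ 1ℤ κ) ℚᵘ.* mkℚᵘ (+ X) 0
    ≤⟨ *≤* cross ⟩
  mkℚᵘ (+ Y) 0
    ≃⟨ toℚᵘ-/ (+ Y) 0 ⟨
  toℚᵘ (+ Y ℚ./ 1) ∎)
  where
  open ℚᵘ.≤-Reasoning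
  c = suc c-1
  natural : suc κ ℕ.* X ℕ.≤ Y ℕ.* (c ℕ.* suc κ) ℕ.+ c ℕ.* X
  natural = ℕ.≤-trans (ℕ.≤-reflexive (ℕ.+-comm X (κ ℕ.* X)))
    (ℕ.+-mono-≤
      (ℕ.≤-trans h (ℕ.≤-reflexive (trans (ℕ.*-comm (suc κ) (Y ℕ.* c)) (ℕ.*-assoc Y c (suc κ)))))
      (ℕ.m≤n*m X c))
  cross : ((1ℤ ℤ.* + suc κ ℤ.+ ℤ.- 1ℤ ℤ.* + c) ℤ.* + X) ℤ.* 1ℤ ℤ.≤ + Y ℤ.* + (c ℕ.* suc κ ℕ.* 1)
  cross = subst₂ ℤ._≤_
    (trans (cong₂ (λ u v → u ℤ.- v) (ℤ.pos-* (suc κ) X) (ℤ.pos-* c X)) (left (+ suc κ) (+ c) (+ X)))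
    (trans (cong (ℤ._- + (c ℕ.* X)) (ℤ.pos-+ (Y ℕ.* (c ℕ.* suc κ)) (c ℕ.* X)))
      (trans (right (+ (Y ℕ.* (c ℕ.* suc κ))) (+ (c ℕ.* X)))
        (trans (ℤ.pos-* Y (c ℕ.* suc κ)) (cong (λ z → + Y ℤ.* + z) (sym (ℕ.*-identityʳ (c ℕ.* suc κ)))))))
    (ℤ.+-monoˡ-≤ (ℤ.- + (c ℕ.* X)) (ℤ.+≤+ natural))
    where
    left : ∀ k c x → k ℤ.* x ℤ.- c ℤ.* x ≡ ((1ℤ ℤ.* k ℤ.+ ℤ.- 1ℤ ℤ.* c) ℤ.* x) ℤ.* 1ℤ
    left = ℤ.solve-∀
    right : ∀ a b → (a ℤ.+ b) ℤ.- b ≡ a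
    right = ℤ.solve-∀

recipℕ-nonNegative : ∀ k → 0ℚ ℚ.≤ recipℕ (suc k)
recipℕ-nonNegative k = ℚ.toℚᵘ-cancel-≤
  (ℚᵘ.≤-respʳ-≃ (ℚᵘ.≃-sym (toℚᵘ-/ 1ℤ k)) (*≤* (ℤ.+≤+ ℕ.z≤n)))

recipℕ-small : ∀ δ → 0ℚ ℚ.< δ → ∃[ K ] (∀ {k} → K ℕ.≤ k → ℚ.∣ recipℕ (suc k) ∣ ℚ.< δ)
recipℕ-small (mkℚ (+ 0) _ _) (*<* (ℤ.+<+ ()))
recipℕ-small (mkℚ -[1+ _ ] _ _) (*<* ())
-- The denominator of `δ` is `suc d` and its numerator at least 1, so `1 / suc k < 1 / suc d ≤ δ`
-- once `k > d`.
recipℕ-small δ@(mkℚ (+ suc a) d _) _ = suc d , λ {k} d<k →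
  subst (ℚ._< δ) (sym (ℚ.0≤p⇒∣p∣≡p (recipℕ-nonNegative k)))
    (ℚ.toℚᵘ-cancel-< (ℚᵘ.<-respˡ-≃ (ℚᵘ.≃-sym (toℚᵘ-/ 1ℤ k)) (*<* (ℤ.+<+ (ℕ.s<s (bound d<k))))))
  where
  bound : ∀ {k} → suc d ℕ.≤ k → d ℕ.+ 0 ℕ.< k ℕ.+ a ℕ.* suc k
  bound {k} d<k = subst (λ z → suc z ℕ.≤ k ℕ.+ a ℕ.* suc k) (sym (ℕ.+-identityʳ d)) (ℕ.≤-trans d<k (ℕ.m≤m+n k (a ℕ.* suc k)))

-- Downward search from `b` for an accuracy whose threshold `n` has passed. The default 0 is
-- legitimate only for `n` at least `N 0`.
level : (ℕ → ℕ) → ℕ → ℕ → ℕ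
level N n zero    = 0
level N n (suc b) with N (suc b) ℕ.≤? n
... | yes _ = suc b
... | no  _ = level N n b

N-level≤ : ∀ (N : ℕ → ℕ) {n} → N 0 ℕ.≤ n → ∀ b → N (level N n b) ℕ.≤ n
N-level≤ N     N0≤n zero    = N0≤n
N-level≤ N {n} N0≤n (suc b) with N (suc b) ℕ.≤? n
... | yes h = h
... | no  _ = N-level≤ N N0≤n b

≤-level : ∀ (N : ℕ → ℕ) {n K} → N K ℕ.≤ n → ∀ {b} → K ℕ.≤ b → K ℕ.≤ level N n b
≤-level N NK≤n {zero} K≤b = K≤b
≤-level N {n} NK≤n {suc b} K≤b with N (suc b) ℕ.≤? n
... | yes _ = K≤b
... | no  h with ℕ.m≤n⇒m<n∨m≡n K≤b
...   | inj₁ K<1+b = ≤-level N NK≤n (ℕ.≤-pred K<1+b)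
...   | inj₂ refl  = contradiction NK≤n h

theorem5 : (t s : ℕ) → s < t →
    Σ (ℕ → ℚ) λ ε → TendsToZero ε ×
    ∃[ N₀ ] (∀ n → N₀ ≤ n →
    ∃[ F ] (Unique {A = Vec Bool n} F ×
    ((recipℕ (t C s) - ε n) *ℚ (+ (n C (t ∸ s)) Data.Rational./ 1) ≤ℚ (+ length F) Data.Rational./ 1) ×
    (∀ x y → x ∈ F → y ∈ F → x ≢ y →
    (2 * s < hamming x y) × (hamming x y ≤ 2 * t))))
theorem5 t s s<t = ε , ε→0 , N 0 , λ n N0≤n →
  let open Packing (proj₂ (packing s<t (κ n)) n (N-level≤ N N0≤n n)) in
    words
  , unique
  , recipℕ-difference-≤ (t C s) (κ n) (n C (t ∸ s)) (length words)
      ⦃ >-nonZero (C-positive (<⇒≤ s<t)) ⦄ dense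
  , distances
  where
  N : ℕ → ℕ
  N κ = proj₁ (packing s<t κ)

  -- Diagonal choice: the cap on the accuracy is `n` itself, so it does not keep `κ n` bounded.
  κ : ℕ → ℕ
  κ n = level N n n

  ε : ℕ → ℚ
  ε n = recipℕ (suc (κ n))

  ε→0 : TendsToZero ε
  ε→0 δ 0<δ = let K , small = recipℕ-small δ 0<δ in
    -- Beyond `K` the search starts at or above `K`, and beyond `N K` it cannot descend past `K`.
    K ⊔ N K , λ n h → small (≤-level N (m⊔n≤o⇒n≤o K (N K) h) (m⊔n≤o⇒m≤o K (N K) h))
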